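{- For online bin packing under the random-order model, the random-order ratio of Best-Fit satisfies $RR^\infty_{\mathrm{BF}}>1.144$.
   Context: Bin packing: an instance is a list $I=(x_1,\dots,x_n)$ of items with sizes in $(0,1]$, to be partitioned into the minimum number $\mathrm{Opt}(I)$ of unit-capacity bins (total size in each bin at most $1$). Best-Fit (BF) processes items in the given order and places each item into the fullest already-opened bin in which it fits, opening a new bin only if it fits nowhere; $\mathrm{BF}(J)$ is the number of bins used on sequence $J$. For a permutation $\sigma$ of $[n]$, $I_\sigma=(x_{\sigma(1)},\dots,x_{\sigma(n)})$. The random-order ratio of an online algorithm $\mathcal A$ is $RR^\infty_{\mathcal A}=\limsup_{m\to\infty}\sup_{I:\mathrm{Opt}(I)=m}\mathbb{E}_\sigma[\mathcal A(I_\sigma)]/\mathrm{Opt}(I)$, where $\sigma$ is uniform over all permutations of $[n]$. -}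

module Defs where

open import Data.Nat as ℕ using (ℕ; zero; suc; _!)
open import Data.Nat.Properties using (_!≢0)
open import Data.Integer using (+_)
open import Data.Rational using (ℚ; 0ℚ; 1ℚ; _+_; _*_; _≤_; _<_; _/_)
open import Data.Rational.Properties using (_≤?_)
open import Data.Fin using (Fin; _≟_)
open import Data.List using (List; []; _∷_; [_]; _++_; map; concatMap; foldl; length; lookup; allFin)
open import Data.List.Relation.Unary.All using (All)
open import Data.Maybe using (Maybe; just; nothing)
open import Data.Bool using (if_then_else_; true; false)
open import Data.Product using (_×_)
open import Relation.Nullary.Decidable using (does)

sumℚ : List ℚ → ℚ
sumℚ = foldl _+_ 0ℚ

ValidInstance : List ℚ → Set
ValidInstance I = All (λ x → (0ℚ < x) × (x ≤ 1ℚ)) I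

load : (I : List ℚ) {k : ℕ} → (Fin (length I) → Fin k) → Fin k → ℚ
load I f b = sumℚ (map (λ i → if does (f i ≟ b) then lookup I i else 0ℚ) (allFin (length I)))

Feasible : List ℚ → ℕ → Set
Feasible I k = Data.Product.Σ (Fin (length I) → Fin k) λ f → ∀ b → load I f b ≤ 1ℚ

IsOpt : List ℚ → ℕ → Set
IsOpt I m = Feasible I m × (∀ k → Feasible I k → m ℕ.≤ k)

-- Best-Fit.  A state is the list of loads of the opened bins.
-- maxFitting x bins: the largest load among bins into which x fits (if any).
maxFitting : ℚ → List ℚ → Maybe ℚ
maxFitting x [] = nothing
maxFitting x (l ∷ ls) with maxFitting x ls | does ((l + x) ≤? 1ℚ)
... | r        | false = r
... | nothing  | true  = just l
... | just l'  | true  = if does (l' ≤? l) then just l else just l'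

addTo : ℚ → ℚ → List ℚ → List ℚ
addTo b x [] = []
addTo b x (l ∷ ls) = if does (l Data.Rational.≟ b) then (l + x) ∷ ls else l ∷ addTo b x ls

bfStep : List ℚ → ℚ → List ℚ
bfStep bins x with maxFitting x bins
... | nothing = bins ++ [ x ]
... | just b  = addTo b x bins

BF : List ℚ → ℕ
BF J = length (foldl bfStep [] J)

-- All orderings of a list, one per permutation σ of the positions (n! lists).
insertions : {A : Set} → A → List A → List (List A)
insertions x [] = [ [ x ] ]
insertions x (y ∷ ys) = (x ∷ y ∷ ys) ∷ map (y ∷_) (insertions x ys)

perms : {A : Set} → List A → List (List A)
perms [] = [ [] ]
perms (x ∷ xs) = concatMap (insertions x) (perms xs)

sumℕ : List ℕ → ℕ
sumℕ = foldl ℕ._+_ 0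

expectedBF : List ℚ → ℚ
expectedBF I = (+ sumℕ (map BF (perms I))) / (length I !) 
  where instance _ = length I !≢0

fromℕ : ℕ → ℚ
fromℕ m = (+ m) / 1

{-# OPTIONS --safe #-}

-- Sizes are multiples of 1/172.  The block {42,42,42,46}, {43,43,43,43},
-- {47,47,78}, {53,53,66} fills four bins exactly, so t copies of it have Opt = 4t.
-- Only bins of load at most 130/172 can still receive an item, and the list of
-- their loads takes just 331 values, so against items drawn uniformly from the
-- block Best-Fit is a finite Markov chain.  A credit function on its states shows
-- that Best-Fit then opens at least 4.5762 bins per 14 items, up to the change in
-- credit.  In a random ordering the items are drawn without replacement and the
-- remaining multiset drifts away from a multiple of the block.  This is paid for by
-- a penalty Q(I)/|I|, quadratic in the deviations of the remaining items I: drawing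
-- an item replaces a deviation D, in expectation, by (1 − 1/N) D, so the penalty
-- decreases by enough to cover the loss in drift.  Hence E[BF] is at least 4.5761 t
-- minus a constant, and 4.5761 / 4 > 1.144.
module Submission where

open import Defs
open import Algebra.Bundles using (CommutativeMonoid)
open import Data.Bool using (Bool; true; false; if_then_else_; _∧_)
open import Data.Fin as Fin using (Fin; zero; suc)
open import Data.Integer as ℤ using (ℤ; +_; -[1+_]; 0ℤ; 1ℤ; ∣_∣; +≤+; +<+; positive)
import Data.Integer.Properties as ℤ
open import Data.Integer.Solver using (module +-*-Solver)
open import Data.List using (List; []; _∷_; [_]; _++_; map; concat; concatMap; foldl; filterᵇ; length; lookup; allFin; tabulate)
import Data.List.Membership.DecPropositional as DecMembership
open import Data.List.Membership.Propositional using (_∈_)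
open import Data.List.Membership.Propositional.Properties using (∈-++⁺ˡ; ∈-++⁺ʳ; ∈-map⁺)
import Data.List.Properties as List
open import Data.List.Relation.Unary.All as All using (All; []; _∷_; all?)
import Data.List.Relation.Unary.All.Properties as All
open import Data.List.Relation.Unary.Any using (here; there)
open import Data.Maybe as Maybe using (Maybe; just; nothing)
open import Data.Nat using (ℕ)
open import Data.Nat as ℕ using (zero; suc; _!; NonZero)
open import Data.Nat.ListAction using (sum)
open import Data.Nat.ListAction.Properties using (sum-++)
import Data.Nat.Properties as ℕ
open import Data.Product using (Σ; _×_; _,_; proj₁; proj₂; map₂)
open import Data.Rational as ℚ using (ℚ; 0ℚ; 1ℚ; _/_; toℚᵘ)
import Data.Rational.Properties as ℚ
open import Data.Rational.Unnormalised as ℚᵘ using (mkℚᵘ; *≡*; *≤*; *<*)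
import Data.Rational.Unnormalised.Properties as ℚᵘ
open import Data.Sum using (_⊎_; inj₁; inj₂; [_,_]′)
open import Function using (_∘_; mk⇔)
open import Relation.Binary.Definitions using (DecidableEquality)
open import Relation.Binary.PropositionalEquality using (_≡_; refl; sym; trans; cong; cong₂; subst; subst₂; module ≡-Reasoning)
open import Relation.Nullary using (Dec; yes; no; contradiction)
open import Relation.Nullary.Decidable using (does; does-⇔; dec-true; dec-false; from-yes; _×-dec_)

-- Sums over the orderings of a list.

module RandomOrder where

  open import Data.Integer using (_+_; _*_; _-_; -_; _≤_)
  open +-*-Solver using (solve; _:=_; _:+_; _:*_; _:-_; :-_; con)

  ∑ : {A : Set} → List A → (A → ℤ) → ℤ
  ∑ []       f = 0ℤ
  ∑ (x ∷ xs) f = f x + ∑ xs f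

  ∑-cong : {A : Set} (xs : List A) {f g : A → ℤ} → (∀ x → f x ≡ g x) → ∑ xs f ≡ ∑ xs g
  ∑-cong []       f≗g = refl
  ∑-cong (x ∷ xs) f≗g = cong₂ _+_ (f≗g x) (∑-cong xs f≗g)

  ∑-++ : {A : Set} (xs ys : List A) (f : A → ℤ) → ∑ (xs ++ ys) f ≡ ∑ xs f + ∑ ys f
  ∑-++ []       ys f = sym (ℤ.+-identityˡ _)
  ∑-++ (x ∷ xs) ys f = trans (cong (_+_ (f x)) (∑-++ xs ys f)) (sym (ℤ.+-assoc (f x) _ _))

  ∑-map : {A B : Set} (g : A → B) (xs : List A) (f : B → ℤ) → ∑ (map g xs) f ≡ ∑ xs (λ x → f (g x))
  ∑-map g []       f = refl
  ∑-map g (x ∷ xs) f = cong (_+_ (f (g x))) (∑-map g xs f)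

  ∑-concatMap : {A B : Set} (g : A → List B) (xs : List A) (f : B → ℤ) →
    ∑ (concatMap g xs) f ≡ ∑ xs (λ x → ∑ (g x) f)
  ∑-concatMap g []       f = refl
  ∑-concatMap g (x ∷ xs) f =
    trans (∑-++ (g x) (concatMap g xs) f) (cong (_+_ (∑ (g x) f)) (∑-concatMap g xs f))

  ∑-distrib-+ : {A : Set} (xs : List A) (f g : A → ℤ) → ∑ xs (λ x → f x + g x) ≡ ∑ xs f + ∑ xs g
  ∑-distrib-+ []       f g = refl
  ∑-distrib-+ (x ∷ xs) f g rewrite ∑-distrib-+ xs f g =
    solve 4 (λ a b c d → (a :+ b) :+ (c :+ d) := (a :+ c) :+ (b :+ d)) refl (f x) (g x) (∑ xs f) (∑ xs g)

  ∑-distribˡ-* : {A : Set} (xs : List A) (c : ℤ) (f : A → ℤ) → ∑ xs (λ x → c * f x) ≡ c * ∑ xs f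
  ∑-distribˡ-* []       c f = sym (ℤ.*-zeroʳ c)
  ∑-distribˡ-* (x ∷ xs) c f rewrite ∑-distribˡ-* xs c f = sym (ℤ.*-distribˡ-+ c (f x) _)

  ∑-const : {A : Set} (xs : List A) (c : ℤ) → ∑ xs (λ _ → c) ≡ + length xs * c
  ∑-const []       c = refl
  ∑-const (x ∷ xs) c rewrite ∑-const xs c = sym (ℤ.suc-* (+ length xs) c)

  ∑-swap : {A B : Set} (xs : List A) (ys : List B) (f : A → B → ℤ) →
    ∑ xs (λ x → ∑ ys (f x)) ≡ ∑ ys (λ y → ∑ xs (λ x → f x y))
  ∑-swap []       ys f = sym (trans (∑-const ys 0ℤ) (ℤ.*-zeroʳ (+ length ys)))
  ∑-swap (x ∷ xs) ys f rewrite ∑-swap xs ys f = sym (∑-distrib-+ ys (f x) _)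

  -- One draw without replacement: `F` receives the drawn entry and the list that remains. Draws go
  -- by position, so equal entries count separately.
  ∑pick : {A : Set} → List A → (A → List A → ℤ) → ℤ
  ∑pick []       F = 0ℤ
  ∑pick (x ∷ xs) F = F x xs + ∑pick xs (λ y r → F y (x ∷ r))

  data Pick {A : Set} (y : A) : List A → List A → Set where
    here  : ∀ {xs} → Pick y xs (y ∷ xs)
    there : ∀ {x r xs} → Pick y r xs → Pick y (x ∷ r) (x ∷ xs)

  Pick-length : {A : Set} {y : A} {r xs : List A} → Pick y r xs → length xs ≡ suc (length r)
  Pick-length here      = refl
  Pick-length (there p) = cong suc (Pick-length p)

  Pick-∑ : {A : Set} {y : A} {r xs : List A} (f : A → ℤ) → Pick y r xs → ∑ r f ≡ ∑ xs f - f y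
  Pick-∑ {y = y} f (here {xs}) = solve 2 (λ a s → s := (a :+ s) :- a) refl (f y) (∑ xs f)
  Pick-∑ {y = y} f (there {x} {r} {xs} p) rewrite Pick-∑ f p =
    solve 3 (λ a s b → a :+ (s :- b) := (a :+ s) :- b) refl (f x) (∑ xs f) (f y)

  ∑pick-mono : {A : Set} (xs : List A) {F G : A → List A → ℤ} →
    (∀ {y r} → Pick y r xs → F y r ≤ G y r) → ∑pick xs F ≤ ∑pick xs G
  ∑pick-mono []       F≤G = ℤ.≤-refl
  ∑pick-mono (x ∷ xs) F≤G = ℤ.+-mono-≤ (F≤G here) (∑pick-mono xs (λ p → F≤G (there p)))

  ∑pick-cong : {A : Set} (xs : List A) {F G : A → List A → ℤ} →
    (∀ {y r} → Pick y r xs → F y r ≡ G y r) → ∑pick xs F ≡ ∑pick xs G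
  ∑pick-cong []       F≗G = refl
  ∑pick-cong (x ∷ xs) F≗G = cong₂ _+_ (F≗G here) (∑pick-cong xs (λ p → F≗G (there p)))

  ∑pick-∑ : {A : Set} (xs : List A) (f : A → ℤ) → ∑pick xs (λ y _ → f y) ≡ ∑ xs f
  ∑pick-∑ []       f = refl
  ∑pick-∑ (x ∷ xs) f = cong (_+_ (f x)) (∑pick-∑ xs f)

  ∑pick-distrib-+ : {A : Set} (xs : List A) (F G : A → List A → ℤ) →
    ∑pick xs (λ y r → F y r + G y r) ≡ ∑pick xs F + ∑pick xs G
  ∑pick-distrib-+ []       F G = refl
  ∑pick-distrib-+ (x ∷ xs) F G
    rewrite ∑pick-distrib-+ xs (λ y r → F y (x ∷ r)) (λ y r → G y (x ∷ r)) =
    solve 4 (λ a b c d → (a :+ b) :+ (c :+ d) := (a :+ c) :+ (b :+ d)) refl (F x xs) (G x xs) _ _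

  ∑pick-distribˡ-* : {A : Set} (xs : List A) (c : ℤ) (F : A → List A → ℤ) →
    ∑pick xs (λ y r → c * F y r) ≡ c * ∑pick xs F
  ∑pick-distribˡ-* []       c F = sym (ℤ.*-zeroʳ c)
  ∑pick-distribˡ-* (x ∷ xs) c F rewrite ∑pick-distribˡ-* xs c (λ y r → F y (x ∷ r)) =
    sym (ℤ.*-distribˡ-+ c (F x xs) _)

  ∑perms : {A : Set} → List A → (List A → ℤ) → ℤ
  ∑perms xs F = ∑ (perms xs) F

  -- perms inserts the head of the list into the orderings of the tail; the
  -- induction below turns this into a recursion on the first entry of an ordering.
  ∑perms-pick : {A : Set} (x : A) (xs : List A) (F : List A → ℤ) →
    ∑perms (x ∷ xs) F ≡ ∑pick (x ∷ xs) (λ y r → ∑perms r (λ τ → F (y ∷ τ)))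
  ∑perms-pick x []       F = sym (ℤ.+-identityʳ (F (x ∷ []) + 0ℤ))
  ∑perms-pick x (z ∷ zs) F = begin
    ∑perms (x ∷ z ∷ zs) F
      ≡⟨ ∑-concatMap (insertions x) (perms (z ∷ zs)) F ⟩
    ∑perms (z ∷ zs) (λ σ → ∑ (insertions x σ) F)
      ≡⟨ ∑perms-pick z zs _ ⟩
    ∑pick (z ∷ zs) (λ y r → ∑perms r (λ τ → F (x ∷ y ∷ τ) + ∑ (map (y ∷_) (insertions x τ)) F))
      ≡⟨ ∑pick-cong (z ∷ zs) (λ {y} {r} _ → trans
           (∑-distrib-+ (perms r) (λ τ → F (x ∷ y ∷ τ)) _)
           (cong (_+_ (∑perms r (λ τ → F (x ∷ y ∷ τ)))) (trans
             (∑-cong (perms r) (λ τ → ∑-map (y ∷_) (insertions x τ) F))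
             (sym (∑-concatMap (insertions x) (perms r) _))))) ⟩
    ∑pick (z ∷ zs) (λ y r → ∑perms r (λ τ → F (x ∷ y ∷ τ)) + ∑perms (x ∷ r) (λ τ → F (y ∷ τ)))
      ≡⟨ ∑pick-distrib-+ (z ∷ zs) (λ y r → ∑perms r (λ τ → F (x ∷ y ∷ τ)))
           (λ y r → ∑perms (x ∷ r) (λ τ → F (y ∷ τ))) ⟩
    ∑pick (z ∷ zs) (λ y r → ∑perms r (λ τ → F (x ∷ y ∷ τ)))
      + ∑pick (z ∷ zs) (λ y r → ∑perms (x ∷ r) (λ τ → F (y ∷ τ)))
      ≡⟨ cong (_+ ∑pick (z ∷ zs) (λ y r → ∑perms (x ∷ r) (λ τ → F (y ∷ τ))))
           (sym (∑perms-pick z zs (λ σ → F (x ∷ σ)))) ⟩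
    ∑pick (x ∷ z ∷ zs) (λ y r → ∑perms r (λ τ → F (y ∷ τ))) ∎
    where open ≡-Reasoning

  ∑perms-1 : {A : Set} (n : ℕ) (xs : List A) → length xs ≡ n → ∑perms xs (λ _ → 1ℤ) ≡ + (n !)
  ∑perms-1 zero    []       _  = refl
  ∑perms-1 (suc n) (x ∷ xs) eq = begin
    ∑perms (x ∷ xs) (λ _ → 1ℤ)
      ≡⟨ ∑perms-pick x xs (λ _ → 1ℤ) ⟩
    ∑pick (x ∷ xs) (λ y r → ∑perms r (λ _ → 1ℤ))
      ≡⟨ ∑pick-cong (x ∷ xs) {λ y r → ∑perms r (λ _ → 1ℤ)} (λ {_} {r} p → ∑perms-1 n r (ℕ.suc-injective (trans (sym (Pick-length p)) eq))) ⟩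
    ∑pick (x ∷ xs) (λ y r → + (n !))
      ≡⟨ trans (∑pick-∑ (x ∷ xs) (λ _ → + (n !))) (∑-const (x ∷ xs) (+ (n !))) ⟩
    + length (x ∷ xs) * + (n !)
      ≡⟨ cong (λ k → + k * + (n !)) eq ⟩
    + suc n * + (n !)
      ≡⟨ sym (ℤ.pos-* (suc n) (n !)) ⟩
    + (suc n !) ∎
    where open ≡-Reasoning

  0≤-+ : ∀ {i j} → 0ℤ ≤ i → 0ℤ ≤ j → 0ℤ ≤ i + j
  0≤-+ = ℤ.+-mono-≤

  0≤-* : ∀ {i j} → 0ℤ ≤ i → 0ℤ ≤ j → 0ℤ ≤ i * j
  0≤-* {+ m} {+ n} _ _ = subst (0ℤ ≤_) (ℤ.pos-* m n) (+≤+ ℕ.z≤n)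

  0≤-² : ∀ i → 0ℤ ≤ i * i
  0≤-² (+ n)    = 0≤-* {+ n} {+ n} (+≤+ ℕ.z≤n) (+≤+ ℕ.z≤n)
  0≤-² -[1+ n ] = +≤+ ℕ.z≤n

  ∑-nonneg : {A : Set} (xs : List A) {f : A → ℤ} → (∀ x → 0ℤ ≤ f x) → 0ℤ ≤ ∑ xs f
  ∑-nonneg []       0≤f = ℤ.≤-refl
  ∑-nonneg (x ∷ xs) 0≤f = 0≤-+ (0≤f x) (∑-nonneg xs 0≤f)

  ∈⇒≤∑ : {A : Set} {x : A} {xs : List A} {f : A → ℤ} → (∀ x → 0ℤ ≤ f x) → x ∈ xs → f x ≤ ∑ xs f
  ∈⇒≤∑ {xs = x ∷ xs} {f} 0≤f (here refl) =
    subst (_≤ f x + ∑ xs f) (ℤ.+-identityʳ (f x)) (ℤ.+-monoʳ-≤ (f x) (∑-nonneg xs 0≤f))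
  ∈⇒≤∑ {xs = z ∷ xs} {f} 0≤f (there x∈xs) =
    subst (_≤ f z + ∑ xs f) (ℤ.+-identityˡ _) (ℤ.+-mono-≤ (0≤f z) (∈⇒≤∑ 0≤f x∈xs))

  Pick-All : {A : Set} {P : A → Set} {y : A} {r xs : List A} → Pick y r xs → All P xs → P y × All P r
  Pick-All here      (py ∷ pxs) = py , pxs
  Pick-All (there p) (px ∷ pxs) = let (py , pr) = Pick-All p pxs in py , px ∷ pr

  -- Σ_y (D − u(y))² = (N − 2) D² + Σ_y u(y)², since the u(y) sum to D.
  ∑pick-square : {A : Set} (xs : List A) (u : A → ℤ) →
    ∑pick xs (λ y r → ∑ r u * ∑ r u) ≡ (+ length xs - + 2) * (∑ xs u * ∑ xs u) + ∑ xs (λ y → u y * u y)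
  ∑pick-square xs u = begin
    ∑pick xs (λ y r → ∑ r u * ∑ r u)
      ≡⟨ ∑pick-cong xs (λ {y} {r} p → trans (cong (λ z → z * z) (Pick-∑ u p))
           (solve 2 (λ d a → (d :- a) :* (d :- a) := (d :* d :+ (:- (con (+ 2) :* d)) :* a) :+ a :* a)
             refl D (u y))) ⟩
    ∑pick xs (λ y _ → (D * D + (- (+ 2 * D)) * u y) + u y * u y)
      ≡⟨ ∑pick-∑ xs _ ⟩
    ∑ xs (λ y → (D * D + (- (+ 2 * D)) * u y) + u y * u y)
      ≡⟨ trans (∑-distrib-+ xs (λ y → D * D + (- (+ 2 * D)) * u y) (λ y → u y * u y))
           (cong (_+ ∑ xs (λ y → u y * u y)) (trans (∑-distrib-+ xs (λ _ → D * D) _)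
             (cong₂ _+_ (∑-const xs (D * D)) (∑-distribˡ-* xs (- (+ 2 * D)) u)))) ⟩
    (+ length xs * (D * D) + (- (+ 2 * D)) * D) + ∑ xs (λ y → u y * u y)
      ≡⟨ cong (_+ ∑ xs (λ y → u y * u y)) (solve 2 (λ n d →
           n :* (d :* d) :+ (:- (con (+ 2) :* d)) :* d := (n :- con (+ 2)) :* (d :* d)) refl (+ length xs) D) ⟩
    (+ length xs - + 2) * (D * D) + ∑ xs (λ y → u y * u y) ∎
    where
    open ≡-Reasoning
    D = ∑ xs u

  -- Drift of a Markov chain fed by draws without replacement.

  module Drift {Y S : Set} (next : S → Y → S) (opens : S → Y → ℕ) where

    cost : S → List Y → ℤ
    cost s []       = 0ℤ
    cost s (y ∷ ys) = + opens s y + cost (next s y) ys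

    cost-nonneg : ∀ s ys → 0ℤ ≤ cost s ys
    cost-nonneg s []       = ℤ.≤-refl
    cost-nonneg s (y ∷ ys) = 0≤-+ (+≤+ ℕ.z≤n) (cost-nonneg (next s y) ys)

    total : List Y → S → ℤ
    total I s = ∑perms I (cost s)

    -- Each item of `I` comes first in `m !` orderings, one for each ordering of the rest. Its own
    -- opening is counted in all of them, and the rest is charged from the next state.
    total-pick : ∀ m I s → length I ≡ suc m →
      total I s ≡ + (m !) * ∑ I (λ y → + opens s y) + ∑pick I (λ y r → total r (next s y))
    total-pick m (x ∷ xs) s eq = begin
      total (x ∷ xs) s
        ≡⟨ ∑perms-pick x xs (cost s) ⟩
      ∑pick (x ∷ xs) (λ y r → ∑perms r (λ τ → + opens s y + cost (next s y) τ))
        ≡⟨ ∑pick-cong (x ∷ xs) (λ {y} {r} p → trans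
             (∑-distrib-+ (perms r) (λ _ → + opens s y) (cost (next s y)))
             (cong (_+ total r (next s y)) (open-part p))) ⟩
      ∑pick (x ∷ xs) (λ y r → + (m !) * + opens s y + total r (next s y))
        ≡⟨ ∑pick-distrib-+ (x ∷ xs) (λ y _ → + (m !) * + opens s y) (λ y r → total r (next s y)) ⟩
      ∑pick (x ∷ xs) (λ y _ → + (m !) * + opens s y) + ∑pick (x ∷ xs) (λ y r → total r (next s y))
        ≡⟨ cong (_+ ∑pick (x ∷ xs) (λ y r → total r (next s y)))
             (trans (∑pick-∑ (x ∷ xs) (λ y → + (m !) * + opens s y))
                    (∑-distribˡ-* (x ∷ xs) (+ (m !)) (λ y → + opens s y))) ⟩
      + (m !) * ∑ (x ∷ xs) (λ y → + opens s y) + ∑pick (x ∷ xs) (λ y r → total r (next s y)) ∎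
      where
      open ≡-Reasoning
      open-part : ∀ {y r} → Pick y r (x ∷ xs) → ∑perms r (λ _ → + opens s y) ≡ + (m !) * + opens s y
      open-part {y} {r} p = begin
        ∑perms r (λ _ → + opens s y)
          ≡⟨ ∑-cong (perms r) (λ _ → sym (ℤ.*-identityʳ (+ opens s y))) ⟩
        ∑perms r (λ _ → + opens s y * 1ℤ)
          ≡⟨ ∑-distribˡ-* (perms r) (+ opens s y) (λ _ → 1ℤ) ⟩
        + opens s y * ∑perms r (λ _ → 1ℤ)
          ≡⟨ cong (_*_ (+ opens s y)) (∑perms-1 m r (ℕ.suc-injective (trans (sym (Pick-length p)) eq))) ⟩
        + opens s y * + (m !)
          ≡⟨ ℤ.*-comm (+ opens s y) (+ (m !)) ⟩
        + (m !) * + opens s y ∎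

    -- Credit and drift are measured in units of 1/`K` bin, and `drift` bounds the sum over a whole
    -- block, not the mean. It asks for one unit more than the rate `ρ` that is proved; this spare
    -- unit pays for remaining items that are out of proportion.
    module Bound (K : ℕ) (Ψ : S → ℕ) (block : List Y) (states : List S) (ρ : ℕ)
      (closed : ∀ {s y} → s ∈ states → y ∈ block → next s y ∈ states)
      (drift : ∀ {s} → s ∈ states →
        + suc ρ ≤ ∑ block (λ y → + K * + opens s y + + Ψ s - + Ψ (next s y)))
      where

      b : ℤ
      b = + length block

      -- Amortised openings: along a run the credits telescope, so the gains add up to `K` times the
      -- cost, plus the initial and minus the final credit.
      gain : S → Y → ℤ
      gain s y = + K * + opens s y + + Ψ s - + Ψ (next s y)

      mean : S → ℤ
      mean s = ∑ block (gain s)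

      -- The centred gain, scaled by the block length to stay in the integers. It sums to zero over
      -- the block, so its sum over `I` measures how far `I` is from the proportions of the block,
      -- as seen from `s`.
      u : S → Y → ℤ
      u s y = b * gain s y - mean s

      deviation : List Y → S → ℤ
      deviation I s = ∑ I (u s)

      -- Summing over all states makes the penalty depend on the remaining items alone, so that it
      -- controls the deviation of whichever state is current.
      Q : List Y → ℤ
      Q I = ∑ states (λ s → deviation I s * deviation I s)

      U : ℤ
      U = ∑ block (λ y → ∑ states (λ s → u s y * u s y))

      -- `surplus-nonneg` uses 2U ≤ m; the extra 1 makes m positive, so that `bounded-step` can
      -- cancel it.
      threshold : ℕ
      threshold = suc (2 ℕ.* ∣ U ∣)

      loss : ℕ
      loss = ρ ℕ.* threshold

      ∑-gain : ∀ I s → ∑ I (gain s) ≡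
        (+ K * ∑ I (λ y → + opens s y) + + length I * + Ψ s) - ∑ I (λ y → + Ψ (next s y))
      ∑-gain I s = begin
        ∑ I (gain s)
          ≡⟨ ∑-distrib-+ I (λ y → + K * + opens s y + + Ψ s) (λ y → - + Ψ (next s y)) ⟩
        ∑ I (λ y → + K * + opens s y + + Ψ s) + ∑ I (λ y → - + Ψ (next s y))
          ≡⟨ cong₂ _+_
               (trans (∑-distrib-+ I (λ y → + K * + opens s y) (λ _ → + Ψ s))
                 (cong₂ _+_ (∑-distribˡ-* I (+ K) (λ y → + opens s y)) (∑-const I (+ Ψ s))))
               (trans (∑-cong I (λ y → sym (ℤ.-1*i≡-i (+ Ψ (next s y)))))
                 (trans (∑-distribˡ-* I (- 1ℤ) (λ y → + Ψ (next s y))) (ℤ.-1*i≡-i _))) ⟩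
        (+ K * ∑ I (λ y → + opens s y) + + length I * + Ψ s) - ∑ I (λ y → + Ψ (next s y)) ∎
        where open ≡-Reasoning

      ∑-u : ∀ I s → deviation I s ≡ b * ∑ I (gain s) - + length I * mean s
      ∑-u I s = trans (∑-distrib-+ I (λ y → b * gain s y) (λ _ → - mean s))
        (cong₂ _+_ (∑-distribˡ-* I b (gain s))
          (trans (∑-const I (- mean s)) (sym (ℤ.neg-distribʳ-* (+ length I) (mean s)))))

      deviation-block : ∀ s → deviation block s ≡ 0ℤ
      deviation-block s = trans (∑-u block s) (ℤ.+-inverseʳ (b * mean s))

      -- With N the length of `I` and V the last sum, the mean of Q(r)/(N - 1) over the draws is
      -- Q(I)/N - (Q(I) - V)/(N(N - 1)). This fall of the penalty is the term `q - V` of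
      -- `surplus-nonneg`.
      ∑pick-Q : ∀ I → ∑pick I (λ y r → Q r) ≡
        (+ length I - + 2) * Q I + ∑ I (λ y → ∑ states (λ s → u s y * u s y))
      ∑pick-Q I = begin
        ∑pick I (λ _ r → Q r)
          ≡⟨ ∑pick-∑-swap I states (λ s r → deviation r s * deviation r s) ⟩
        ∑ states (λ s → ∑pick I (λ _ r → deviation r s * deviation r s))
          ≡⟨ ∑-cong states (λ s → ∑pick-square I (u s)) ⟩
        ∑ states (λ s → (+ length I - + 2) * (deviation I s * deviation I s) + ∑ I (λ y → u s y * u s y))
          ≡⟨ ∑-distrib-+ states (λ s → (+ length I - + 2) * (deviation I s * deviation I s)) _ ⟩
        ∑ states (λ s → (+ length I - + 2) * (deviation I s * deviation I s))
          + ∑ states (λ s → ∑ I (λ y → u s y * u s y))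
          ≡⟨ cong₂ _+_ (∑-distribˡ-* states (+ length I - + 2) (λ s → deviation I s * deviation I s))
               (∑-swap states I (λ s y → u s y * u s y)) ⟩
        (+ length I - + 2) * Q I + ∑ I (λ y → ∑ states (λ s → u s y * u s y)) ∎
        where
        open ≡-Reasoning
        ∑pick-∑-swap : ∀ {A B : Set} (xs : List A) (ys : List B) (F : B → List A → ℤ) →
          ∑pick xs (λ _ r → ∑ ys (λ y → F y r)) ≡ ∑ ys (λ y → ∑pick xs (λ _ r → F y r))
        ∑pick-∑-swap []       ys F = sym (trans (∑-const ys 0ℤ) (ℤ.*-zeroʳ (+ length ys)))
        ∑pick-∑-swap (x ∷ xs) ys F rewrite ∑pick-∑-swap xs ys (λ y r → F y (x ∷ r)) =
          sym (∑-distrib-+ ys (λ y → F y xs) _)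

      U-nonneg : 0ℤ ≤ U
      U-nonneg = ∑-nonneg block (λ y → ∑-nonneg states (λ s → 0≤-² (u s y)))

      Q-nonneg : ∀ I → 0ℤ ≤ Q I
      Q-nonneg I = ∑-nonneg states (λ s → 0≤-² (deviation I s))

      variation-bound : ∀ I → All (_∈ block) I →
        ∑ I (λ y → ∑ states (λ s → u s y * u s y)) ≤ + length I * U
      variation-bound []      []         = ℤ.≤-refl
      variation-bound (y ∷ I) (y∈ ∷ I⊆) = ℤ.≤-trans
        (ℤ.+-mono-≤ (∈⇒≤∑ (λ y → ∑-nonneg states (λ s → 0≤-² (u s y))) y∈) (variation-bound I I⊆))
        (ℤ.≤-reflexive (sym (ℤ.suc-* (+ length I) U)))

      -- With N = m + 1 items left and D the deviation of the current state, the
      -- surplus N·1 + D of the drift over N·ρ can be negative, but twice the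
      -- quantity below is (m + D)² + (Q − D²) + Q + 2(NU − V) + (m − 2U)m + 2(m − U).
      surplus-nonneg : ∀ m D q V → threshold ℕ.≤ m → D * D ≤ q → V ≤ + suc m * U →
        0ℤ ≤ + m * (+ suc m + D) + q - V
      surplus-nonneg m D q V t≤m D²≤q V≤ = ℤ.*-cancelˡ-≤-pos 0ℤ _ (+ 2) (subst (0ℤ ≤_) eq
        (0≤-+ (0≤-+ (0≤-+ (0≤-² (M + D)) (ℤ.i≤j⇒0≤j-i D²≤q)) (0≤-+ (ℤ.i≤j⇒0≤j-i V≤) (ℤ.i≤j⇒0≤j-i V≤)))
              (0≤-+ (0≤-* 0≤M-2U (+≤+ ℕ.z≤n)) (0≤-+ (0≤-+ 0≤M-2U (+≤+ ℕ.z≤n)) 0≤q))))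
        where
        M = + m
        0≤q : 0ℤ ≤ q
        0≤q = ℤ.≤-trans (0≤-² D) D²≤q
        0≤M-2U : 0ℤ ≤ M - + 2 * U
        0≤M-2U = ℤ.i≤j⇒0≤j-i (subst (_≤ M)
          (trans (ℤ.pos-* 2 ∣ U ∣) (cong (_*_ (+ 2)) (ℤ.0≤i⇒+∣i∣≡i U-nonneg)))
          (+≤+ (ℕ.≤-trans (ℕ.n≤1+n _) t≤m)))
        eq : (M + D) * (M + D) + (q - D * D) + ((+ suc m * U - V) + (+ suc m * U - V))
             + ((M - + 2 * U) * M + ((M - + 2 * U + M) + q))
           ≡ + 2 * (M * (+ suc m + D) + q - V)
        eq = solve 5 (λ m d q v u → let n = con (+ 1) :+ m in
          (m :+ d) :* (m :+ d) :+ (q :- d :* d) :+ ((n :* u :- v) :+ (n :* u :- v))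
             :+ ((m :- con (+ 2) :* u) :* m :+ ((m :- con (+ 2) :* u :+ m) :+ q))
           := con (+ 2) :* (m :* (n :+ d) :+ q :- v)) refl M D q V U

      -- The total over the n! orderings of I is at least n!/(bK) times
      -- ρn − bΨ(s) − loss − Q(I)/n, with denominators cleared.  For n ≤ threshold the
      -- loss makes this vacuous.
      Bounded : ℕ → List Y → S → Set
      Bounded n I s =
        + n * + (n !) * (+ ρ * + n - b * + Ψ s - + loss) ≤ + n * (b * + K * total I s) + + (n !) * Q I

      bounded-short : ∀ n I s → n ℕ.≤ threshold → Bounded n I s
      bounded-short n I s n≤t = ℤ.≤-trans
        (ℤ.0≤i-j⇒j≤i (subst (0ℤ ≤_) flip
          (0≤-* (0≤-* {+ n} (+≤+ ℕ.z≤n) (+≤+ ℕ.z≤n))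
            (0≤-+ (0≤-* {+ ρ} (+≤+ ℕ.z≤n) (ℤ.i≤j⇒0≤j-i (+≤+ n≤t)))
                  (0≤-* {b} (+≤+ ℕ.z≤n) (+≤+ ℕ.z≤n))))))
        (0≤-+ (0≤-* {+ n} (+≤+ ℕ.z≤n) (0≤-* (0≤-* {b} {+ K} (+≤+ ℕ.z≤n) (+≤+ ℕ.z≤n))
                (∑-nonneg (perms I) (cost-nonneg s))))
              (0≤-* {+ (n !)} (+≤+ ℕ.z≤n) (Q-nonneg I)))
        where
        flip : + n * + (n !) * (+ ρ * (+ threshold - + n) + b * + Ψ s)
          ≡ 0ℤ - + n * + (n !) * (+ ρ * + n - b * + Ψ s - + loss)
        flip = trans
          (solve 6 (λ x r t n b p → x :* (r :* (t :- n) :+ b :* p)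
            := con 0ℤ :- x :* (r :* n :- b :* p :- r :* t)) refl
            (+ n * + (n !)) (+ ρ) (+ threshold) (+ n) b (+ Ψ s))
          (cong (λ l → 0ℤ - + n * + (n !) * (+ ρ * + n - b * + Ψ s - l)) (sym (ℤ.pos-* ρ threshold)))

      -- The hypotheses are summed over the choice of the first item. The gains of that item, summed
      -- over `I` and multiplied by b, give N·mean + D, which is at least Nρ + (N + D). The part N +
      -- D may be negative, but `surplus-nonneg` covers it with the fall of the penalty.
      bounded-step : ∀ m I {s} → length I ≡ suc m → threshold ℕ.≤ m → All (_∈ block) I → s ∈ states →
        (∀ {y r} → Pick y r I → Bounded m r (next s y)) → Bounded (suc m) I s
      bounded-step m I {s} |I| t≤m I⊆ s∈ rec = begin
        N * + (suc m !) * Z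
          ≡⟨ cong (λ z → N * z * Z) (ℤ.pos-* (suc m) (m !)) ⟩
        N * (N * f) * Z
          ≡⟨ ℤ.*-assoc N (N * f) Z ⟩
        N * (N * f * Z)
          -- `main` carries a further factor `M`, the denominator of the penalty at size `m`; it is
          -- positive because `threshold` is.
          ≤⟨ ℤ.*-monoˡ-≤-nonNeg N (ℤ.*-cancelˡ-≤-pos (N * f * Z) (b * k * total I s + f * q) M
               ⦃ positive (ℤ.<-≤-trans (+<+ (ℕ.s≤s ℕ.z≤n)) (+≤+ t≤m)) ⦄ main) ⟩
        N * (b * k * total I s + f * q)
          ≡⟨ solve 4 (λ n x f q → n :* (x :+ f :* q) := n :* x :+ (n :* f) :* q) refl
               N (b * k * total I s) f q ⟩
        N * (b * k * total I s) + (N * f) * q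
          ≡⟨ cong (λ z → N * (b * k * total I s) + z * q) (sym (ℤ.pos-* (suc m) (m !))) ⟩
        N * (b * k * total I s) + + (suc m !) * q ∎
        where
        open ℤ.≤-Reasoning
        M = + m
        N = + suc m
        f = + (m !)
        k = + K
        l = + loss
        q = Q I
        D = deviation I s
        Z = + ρ * N - b * + Ψ s - l
        O = ∑ I (λ y → + opens s y)
        Ψ′ = ∑ I (λ y → + Ψ (next s y))
        P = ∑pick I (λ y r → total r (next s y))
        V = ∑ I (λ y → ∑ states (λ s → u s y * u s y))
        lower = λ (y : Y) (r : List Y) → M * f * (+ ρ * M - b * + Ψ (next s y) - l)
        upper = λ (y : Y) (r : List Y) → M * (b * k * total r (next s y)) + f * Q r
        ∑lower : ∑pick I lower ≡ M * f * (N * (+ ρ * M - l) - b * Ψ′)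
        ∑lower = trans (∑pick-∑ I (λ y → M * f * (+ ρ * M - b * + Ψ (next s y) - l)))
          (trans (∑-distribˡ-* I (M * f) (λ y → + ρ * M - b * + Ψ (next s y) - l))
          (cong (_*_ (M * f)) (trans
            (∑-cong I (λ y → solve 4 (λ a c p l → (a :- c :* p) :- l := (a :- l) :+ (:- c) :* p) refl
              (+ ρ * M) b (+ Ψ (next s y)) l))
            (trans (∑-distrib-+ I (λ _ → + ρ * M - l) (λ y → - b * + Ψ (next s y)))
              (cong₂ _+_ (trans (∑-const I (+ ρ * M - l)) (cong (λ n → + n * (+ ρ * M - l)) |I|))
                         (trans (∑-distribˡ-* I (- b) (λ y → + Ψ (next s y)))
                                (sym (ℤ.neg-distribˡ-* b Ψ′))))))))
        ∑upper : ∑pick I upper ≡ M * (b * k * P) + f * ((N - + 2) * q + V)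
        ∑upper = trans (∑pick-distrib-+ I (λ y r → M * (b * k * total r (next s y))) (λ _ r → f * Q r))
          (cong₂ _+_
            (trans (∑pick-distribˡ-* I M (λ y r → b * k * total r (next s y)))
                   (cong (_*_ M) (∑pick-distribˡ-* I (b * k) (λ y r → total r (next s y)))))
            (trans (∑pick-distribˡ-* I f (λ _ r → Q r)) (cong (_*_ f) (trans (∑pick-Q I)
              (cong (λ l → (+ l - + 2) * q + V) |I|)))))
        D≡ : D ≡ b * ((k * O + N * + Ψ s) - Ψ′) - N * mean s
        D≡ = trans (∑-u I s) (trans (cong (λ g → b * g - + length I * mean s) (∑-gain I s))
          (cong (λ n → b * ((k * O + + n * + Ψ s) - Ψ′) - + n * mean s) |I|))
        -- The three summands are the slacks of the summed hypotheses, of `surplus-nonneg` and of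
        -- the drift at `s`; together they are exactly the slack of `main`.
        certificate : (M * (b * k * P) + f * ((N - + 2) * q + V) - M * f * (N * (+ ρ * M - l) - b * Ψ′))
            + f * (M * (N + D) + q - V) + f * M * N * (mean s - + suc ρ)
          ≡ M * (b * k * total I s + f * q) - M * (N * f * Z)
        certificate = trans
          (cong (λ d → (M * (b * k * P) + f * ((N - + 2) * q + V) - M * f * (N * (+ ρ * M - l) - b * Ψ′))
            + f * (M * (N + d) + q - V) + f * M * N * (mean s - + suc ρ)) D≡)
          (trans
            (solve 13 (λ M b k P f q V ρ C Ψ′ O p g → let N = con (+ 1) :+ M in
               (M :* (b :* k :* P) :+ f :* ((N :- con (+ 2)) :* q :+ V) :- M :* f :* (N :* (ρ :* M :- C) :- b :* Ψ′))
                 :+ f :* (M :* (N :+ (b :* ((k :* O :+ N :* p) :- Ψ′) :- N :* g)) :+ q :- V)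
                 :+ f :* M :* N :* (g :- (con (+ 1) :+ ρ))
               := M :* (b :* k :* (f :* O :+ P) :+ f :* q) :- M :* (N :* f :* (ρ :* N :- b :* p :- C)))
               refl M b k P f q V (+ ρ) l Ψ′ O (+ Ψ s) (mean s))
            (cong (λ w → M * (b * k * w + f * q) - M * (N * f * Z)) (sym (total-pick m I s |I|))))
        main : M * (N * f * Z) ≤ M * (b * k * total I s + f * q)
        main = ℤ.0≤i-j⇒j≤i (subst (0ℤ ≤_) certificate (0≤-+ (0≤-+
          (ℤ.i≤j⇒0≤j-i (subst₂ _≤_ ∑lower ∑upper (∑pick-mono I {lower} {upper} rec)))
          (0≤-* {f} (+≤+ ℕ.z≤n) (surplus-nonneg m D q V t≤m
            (∈⇒≤∑ (λ t → 0≤-² (deviation I t)) s∈)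
            (subst (λ l → V ≤ + l * U) |I| (variation-bound I I⊆)))))
          (0≤-* (0≤-* (0≤-* {f} {M} (+≤+ ℕ.z≤n) (+≤+ ℕ.z≤n)) (+≤+ ℕ.z≤n)) (ℤ.i≤j⇒0≤j-i (drift s∈)))))

      bounded : ∀ n I {s} → length I ≡ n → All (_∈ block) I → s ∈ states → Bounded n I s
      bounded n I |I| I⊆ s∈ with n ℕ.≤? threshold
      ... | yes n≤t = bounded-short n I _ n≤t
      bounded zero    I |I| I⊆ s∈ | no n≰t = contradiction ℕ.z≤n n≰t
      bounded (suc m) I |I| I⊆ s∈ | no n≰t =
        bounded-step m I |I| (ℕ.≤-pred (ℕ.≰⇒> n≰t)) I⊆ s∈ (λ {_} {r} p →
          bounded m r (ℕ.suc-injective (trans (sym (Pick-length p)) |I|)) (proj₂ (Pick-All p I⊆))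
            (closed s∈ (proj₁ (Pick-All p I⊆))))

      -- If `I` has the proportions of the block, every centred gain sums to zero over `I` and the
      -- penalty vanishes. The credit vanishes by `Ψ s ≡ 0`, so only the constant `loss` is left.
      -- Balance is expressed by sums of functions, which avoids counting multiplicities.
      balanced-bound : ∀ n .⦃ _ : NonZero n ⦄ {I s} → length I ≡ n → All (_∈ block) I →
        s ∈ states → Ψ s ≡ 0 → (∀ f → ∑ block f ≡ 0ℤ → ∑ I f ≡ 0ℤ) →
        + (n !) * (+ ρ * + n - + loss) ≤ + length block * + K * total I s
      balanced-bound n@(suc _) {I} {s} |I| I⊆ s∈ Ψ≡0 balanced = ℤ.*-cancelˡ-≤-pos _ _ (+ n) (begin
        + n * (+ (n !) * (+ ρ * + n - + loss))             ≡⟨ ℤ.*-assoc (+ n) (+ (n !)) (+ ρ * + n - + loss) ⟨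
        + n * + (n !) * (+ ρ * + n - + loss)               ≡⟨ cong (λ z → + n * + (n !) * (z - + loss)) no-credit ⟨
        + n * + (n !) * (+ ρ * + n - b * + Ψ s - + loss)   ≤⟨ bounded n I |I| I⊆ s∈ ⟩
        + n * (b * + K * total I s) + + (n !) * Q I        ≡⟨ cong (λ q → + n * (b * + K * total I s) + + (n !) * q) Q≡0 ⟩
        + n * (b * + K * total I s) + + (n !) * 0ℤ         ≡⟨ cong (_+_ (+ n * (b * + K * total I s))) (ℤ.*-zeroʳ (+ (n !))) ⟩
        + n * (b * + K * total I s) + 0ℤ                   ≡⟨ ℤ.+-identityʳ _ ⟩
        + n * (b * + K * total I s)                        ∎)
        where
        open ℤ.≤-Reasoning
        Q≡0 : Q I ≡ 0ℤ
        Q≡0 = trans (∑-cong states (λ t → cong (λ d → d * d) (balanced (u t) (deviation-block t))))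
          (trans (∑-const states 0ℤ) (ℤ.*-zeroʳ (+ length states)))
        no-credit : + ρ * + n - b * + Ψ s ≡ + ρ * + n
        no-credit = trans (cong (λ p → + ρ * + n - b * + p) Ψ≡0)
          (trans (cong (λ z → + ρ * + n - z) (ℤ.*-zeroʳ b)) (ℤ.+-identityʳ (+ ρ * + n)))

open RandomOrder

-- Orderings under predicates and maps.

∑-cong-All : {A : Set} {xs : List A} {f g : A → ℤ} → All (λ x → f x ≡ g x) xs → ∑ xs f ≡ ∑ xs g
∑-cong-All []         = refl
∑-cong-All (eq ∷ eqs) = cong₂ ℤ._+_ eq (∑-cong-All eqs)

sumℕ-∑ : {A : Set} (f : A → ℕ) (xs : List A) → + sumℕ (map f xs) ≡ ∑ xs (λ x → + f x)
sumℕ-∑ f xs = trans (go 0 xs) (ℤ.+-identityˡ _)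
  where
  go : ∀ n xs → + foldl ℕ._+_ n (map f xs) ≡ + n ℤ.+ ∑ xs (λ x → + f x)
  go n []       = sym (ℤ.+-identityʳ (+ n))
  go n (x ∷ xs) = trans (go (n ℕ.+ f x) xs) (ℤ.+-assoc (+ n) (+ f x) (∑ xs (λ x → + f x)))

insertions-All : {A : Set} {P : A → Set} {x : A} {ys : List A} → P x → All P ys → All (All P) (insertions x ys)
insertions-All px []         = (px ∷ []) ∷ []
insertions-All px (py ∷ pys) = (px ∷ py ∷ pys) ∷ All.map⁺ (All.map (py ∷_) (insertions-All px pys))

perms-All : {A : Set} {P : A → Set} {xs : List A} → All P xs → All (All P) (perms xs)
perms-All []         = [] ∷ []
perms-All (px ∷ pxs) = All.concat⁺ (All.map⁺ (All.map (insertions-All px) (perms-All pxs)))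

insertions-map : {A B : Set} (f : A → B) (x : A) (ys : List A) →
  insertions (f x) (map f ys) ≡ map (map f) (insertions x ys)
insertions-map f x []       = refl
insertions-map f x (y ∷ ys) = cong (_∷_ _) (begin
  map (f y ∷_) (insertions (f x) (map f ys))  ≡⟨ cong (map (f y ∷_)) (insertions-map f x ys) ⟩
  map (f y ∷_) (map (map f) (insertions x ys)) ≡⟨ List.map-∘ (insertions x ys) ⟨
  map (map f ∘ (y ∷_)) (insertions x ys)       ≡⟨ List.map-∘ (insertions x ys) ⟩
  map (map f) (map (y ∷_) (insertions x ys))   ∎)
  where open ≡-Reasoning

perms-map : {A B : Set} (f : A → B) (xs : List A) → perms (map f xs) ≡ map (map f) (perms xs)
perms-map f []       = refl
perms-map f (x ∷ xs) = begin
  concatMap (insertions (f x)) (perms (map f xs))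
    ≡⟨ cong (concatMap (insertions (f x))) (perms-map f xs) ⟩
  concatMap (insertions (f x)) (map (map f) (perms xs))
    ≡⟨ List.concatMap-map (insertions (f x)) (map f) (perms xs) ⟩
  concatMap (insertions (f x) ∘ map f) (perms xs)
    ≡⟨ List.concatMap-cong (insertions-map f x) (perms xs) ⟩
  concatMap (map (map f) ∘ insertions x) (perms xs)
    ≡⟨ List.map-concatMap (map f) (insertions x) (perms xs) ⟨
  map (map f) (concatMap (insertions x) (perms xs)) ∎
  where open ≡-Reasoning

-- Best-Fit in integer units of 1/B.

module BestFit (B-1 : ℕ) where

  B : ℕ
  B = suc B-1

  frac : ℕ → ℚ
  frac k = + k / B

  toℚᵘ-frac : ∀ k → toℚᵘ (frac k) ℚᵘ.≃ mkℚᵘ (+ k) B-1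
  toℚᵘ-frac k = ℚ.toℚᵘ-fromℚᵘ (mkℚᵘ (+ k) B-1)

  frac-+ : ∀ k l → frac k ℚ.+ frac l ≡ frac (k ℕ.+ l)
  frac-+ k l = ℚ.toℚᵘ-injective (begin
    toℚᵘ (frac k ℚ.+ frac l)                ≈⟨ ℚ.toℚᵘ-homo-+ (frac k) (frac l) ⟩
    toℚᵘ (frac k) ℚᵘ.+ toℚᵘ (frac l)        ≈⟨ ℚᵘ.+-cong (toℚᵘ-frac k) (toℚᵘ-frac l) ⟩
    mkℚᵘ (+ k) B-1 ℚᵘ.+ mkℚᵘ (+ l) B-1      ≈⟨ *≡* (cross (+ k) (+ l) (+ B)) ⟩
    mkℚᵘ (+ (k ℕ.+ l)) B-1                  ≈⟨ toℚᵘ-frac (k ℕ.+ l) ⟨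
    toℚᵘ (frac (k ℕ.+ l))                   ∎)
    where
    open import Relation.Binary.Reasoning.Setoid ℚᵘ.≃-setoid
    open import Data.Integer.Solver using (module +-*-Solver)
    open +-*-Solver
    cross : ∀ k l b → (k ℤ.* b ℤ.+ l ℤ.* b) ℤ.* b ≡ (k ℤ.+ l) ℤ.* (b ℤ.* b)
    cross = solve 3 (λ k l b → (k :* b :+ l :* b) :* b := (k :+ l) :* (b :* b)) refl

  frac-mono-≤ : ∀ {k l} → k ℕ.≤ l → frac k ℚ.≤ frac l
  frac-mono-≤ {k} {l} k≤l = ℚ.toℚᵘ-cancel-≤
    (ℚᵘ.≤-respˡ-≃ (ℚᵘ.≃-sym (toℚᵘ-frac k)) (ℚᵘ.≤-respʳ-≃ (ℚᵘ.≃-sym (toℚᵘ-frac l))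
      (*≤* (ℤ.*-monoʳ-≤-nonNeg (+ B) (ℤ.+≤+ k≤l)))))

  frac-cancel-≤ : ∀ {k l} → frac k ℚ.≤ frac l → k ℕ.≤ l
  frac-cancel-≤ {k} {l} p≤q
    with *≤* h ← ℚᵘ.≤-respˡ-≃ (toℚᵘ-frac k) (ℚᵘ.≤-respʳ-≃ (toℚᵘ-frac l) (ℚ.toℚᵘ-mono-≤ p≤q)) =
    ℤ.drop‿+≤+ (ℤ.*-cancelʳ-≤-pos (+ k) (+ l) (+ B) h)

  frac-injective : ∀ {k l} → frac k ≡ frac l → k ≡ l
  frac-injective eq =
    ℕ.≤-antisym (frac-cancel-≤ (ℚ.≤-reflexive eq)) (frac-cancel-≤ (ℚ.≤-reflexive (sym eq)))

  frac-* : ∀ m → frac (m ℕ.* B) ≡ fromℕ m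
  frac-* m = ℚ.fromℚᵘ-cong {mkℚᵘ (+ (m ℕ.* B)) B-1} {mkℚᵘ (+ m) 0}
    (*≡* (trans (ℤ.*-identityʳ _) (ℤ.pos-* m B)))

  frac-B : frac B ≡ 1ℚ
  frac-B = trans (cong frac (sym (ℕ.*-identityˡ B))) (frac-* 1)

  -- `fit`, `put` and `step` are `maxFitting`, `addTo` and `bfStep` on numerators, so that the
  -- states of the chain can be computed by evaluation.
  fit : ℕ → List ℕ → Maybe ℕ
  fit x [] = nothing
  fit x (l ∷ ls) with fit x ls | does (l ℕ.+ x ℕ.≤? B)
  ... | r       | false = r
  ... | nothing | true  = just l
  ... | just l′ | true  = if does (l′ ℕ.≤? l) then just l else just l′

  put : ℕ → ℕ → List ℕ → List ℕ
  put b x []       = []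
  put b x (l ∷ ls) = if does (l ℕ.≟ b) then (l ℕ.+ x) ∷ ls else l ∷ put b x ls

  step : List ℕ → ℕ → List ℕ
  step bins x with fit x bins
  ... | nothing = bins ++ [ x ]
  ... | just b  = put b x bins

  fits-frac : ∀ l x → does (frac l ℚ.+ frac x ℚ.≤? 1ℚ) ≡ does (l ℕ.+ x ℕ.≤? B)
  fits-frac l x = does-⇔ (mk⇔
    (λ h → frac-cancel-≤ (subst₂ ℚ._≤_ (frac-+ l x) (sym frac-B) h))
    (λ h → subst₂ ℚ._≤_ (sym (frac-+ l x)) frac-B (frac-mono-≤ h)))
    (frac l ℚ.+ frac x ℚ.≤? 1ℚ) (l ℕ.+ x ℕ.≤? B)

  maxFitting-frac : ∀ x ls → maxFitting (frac x) (map frac ls) ≡ Maybe.map frac (fit x ls)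
  maxFitting-frac x [] = refl
  maxFitting-frac x (l ∷ ls) rewrite maxFitting-frac x ls | fits-frac l x
    with fit x ls | does (l ℕ.+ x ℕ.≤? B)
  ... | nothing | false = refl
  ... | just _  | false = refl
  ... | nothing | true  = refl
  ... | just l′ | true
    rewrite does-⇔ (mk⇔ frac-cancel-≤ frac-mono-≤) (frac l′ ℚ.≤? frac l) (l′ ℕ.≤? l)
    with does (l′ ℕ.≤? l)
  ... | true  = refl
  ... | false = refl

  addTo-frac : ∀ b x ls → addTo (frac b) (frac x) (map frac ls) ≡ map frac (put b x ls)
  addTo-frac b x [] = refl
  addTo-frac b x (l ∷ ls)
    rewrite does-⇔ (mk⇔ (frac-injective {l} {b}) (cong frac)) (frac l ℚ.≟ frac b) (l ℕ.≟ b)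
    with does (l ℕ.≟ b)
  ... | true  = cong (_∷ map frac ls) (frac-+ l x)
  ... | false = cong (frac l ∷_) (addTo-frac b x ls)

  bfStep-frac : ∀ ls x → bfStep (map frac ls) (frac x) ≡ map frac (step ls x)
  bfStep-frac ls x rewrite maxFitting-frac x ls with fit x ls
  ... | nothing = sym (List.map-++ frac ls [ x ])
  ... | just b  = addTo-frac b x ls

  foldl-frac : ∀ ls J → foldl bfStep (map frac ls) (map frac J) ≡ map frac (foldl step ls J)
  foldl-frac ls []      = refl
  foldl-frac ls (x ∷ J) rewrite bfStep-frac ls x = foldl-frac (step ls x) J

  -- A bin matters for the future only while the smallest item, of size a, still fits.
  module Open (a : ℕ) where

    live : ℕ → Bool
    live l = does (l ℕ.+ a ℕ.≤? B)

    prune : List ℕ → List ℕ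
    prune = filterᵇ live

    next : List ℕ → ℕ → List ℕ
    next s x = prune (step s x)

    opens : List ℕ → ℕ → ℕ
    opens s x with fit x s
    ... | nothing = 1
    ... | just _  = 0

    open Drift next opens public

    fits⇒live : ∀ {l x} → a ℕ.≤ x → l ℕ.+ x ℕ.≤ B → live l ≡ true
    fits⇒live {l} a≤x h = dec-true (l ℕ.+ a ℕ.≤? B) (ℕ.≤-trans (ℕ.+-monoʳ-≤ l a≤x) h)

    -- A bin that takes an item of size at least `a` would also take one of size `a`, so the
    -- candidates for `x` are all live.
    fit-prune : ∀ {x} → a ℕ.≤ x → ∀ ls → fit x (prune ls) ≡ fit x ls
    fit-prune a≤x [] = refl
    fit-prune {x} a≤x (l ∷ ls) with l ℕ.+ x ℕ.≤? B
    ... | yes h rewrite fits⇒live a≤x h | fit-prune a≤x ls | dec-true (l ℕ.+ x ℕ.≤? B) h = refl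
    ... | no ¬h with live l
    ...   | true  rewrite fit-prune a≤x ls | dec-false (l ℕ.+ x ℕ.≤? B) ¬h = refl
    ...   | false rewrite fit-prune a≤x ls | dec-false (l ℕ.+ x ℕ.≤? B) ¬h = refl

    fit-fits : ∀ x ls {b} → fit x ls ≡ just b → b ℕ.+ x ℕ.≤ B
    fit-fits x (l ∷ ls) eq with fit x ls in eq′ | l ℕ.+ x ℕ.≤? B
    ... | just l′ | no ¬h rewrite dec-false (l ℕ.+ x ℕ.≤? B) ¬h = fit-fits x ls (trans eq′ eq)
    ... | nothing | no ¬h rewrite dec-false (l ℕ.+ x ℕ.≤? B) ¬h = contradiction eq λ ()
    ... | nothing | yes h rewrite dec-true (l ℕ.+ x ℕ.≤? B) h with refl ← eq = h
    ... | just l′ | yes h rewrite dec-true (l ℕ.+ x ℕ.≤? B) h with does (l′ ℕ.≤? l)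
    ...   | true  with refl ← eq = h
    ...   | false = fit-fits x ls (trans eq′ eq)

    -- Pruning keeps every bin of the live load `b`, in order, so the first bin of load `b` is the
    -- same before and after.
    prune-put : ∀ {b} x → live b ≡ true → ∀ ls → prune (put b x (prune ls)) ≡ prune (put b x ls)
    prune-put x live-b [] = refl
    prune-put {b} x live-b (l ∷ ls) with l ℕ.≟ b
    ... | yes refl rewrite live-b | dec-true (l ℕ.≟ l) refl with live (l ℕ.+ x)
    ...   | true  = cong (_ ∷_) (List.filter-idem _ ls)
    ...   | false = List.filter-idem _ ls
    prune-put {b} x live-b (l ∷ ls) | no l≢b with live l in live-l
    ...   | true  rewrite dec-false (l ℕ.≟ b) l≢b | live-l = cong (l ∷_) (prune-put x live-b ls)
    ...   | false rewrite dec-false (l ℕ.≟ b) l≢b | live-l = prune-put x live-b ls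

    -- This makes the list of live loads a state in its own right: its successor depends on no
    -- closed bin.
    next-prune : ∀ {x} → a ℕ.≤ x → ∀ ls → next (prune ls) x ≡ prune (step ls x)
    next-prune {x} a≤x ls rewrite fit-prune a≤x ls with fit x ls in eq
    ... | nothing = begin
      prune (prune ls ++ [ x ])         ≡⟨ List.filter-++ _ (prune ls) [ x ] ⟩
      prune (prune ls) ++ prune [ x ]   ≡⟨ cong (_++ prune [ x ]) (List.filter-idem _ ls) ⟩
      prune ls ++ prune [ x ]           ≡⟨ List.filter-++ _ ls [ x ] ⟨
      prune (ls ++ [ x ])               ∎
      where open ≡-Reasoning
    ... | just b  = prune-put x (fits⇒live a≤x (fit-fits x ls eq)) ls

    length-put : ∀ b x ls → length (put b x ls) ≡ length ls
    length-put b x [] = refl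
    length-put b x (l ∷ ls) with does (l ℕ.≟ b)
    ... | true  = refl
    ... | false = cong suc (length-put b x ls)

    length-step : ∀ {x} → a ℕ.≤ x → ∀ ls → length (step ls x) ≡ opens (prune ls) x ℕ.+ length ls
    length-step {x} a≤x ls rewrite fit-prune a≤x ls with fit x ls
    ... | nothing = trans (List.length-++ ls) (ℕ.+-comm (length ls) 1)
    ... | just b  = length-put b x ls

    -- Pruned bins still count in the final number of bins, which is why `cost` counts openings and
    -- not the bins of a state.
    length-foldl-step : ∀ ls {J} → All (a ℕ.≤_) J →
      + length (foldl step ls J) ≡ + length ls ℤ.+ cost (prune ls) J
    length-foldl-step ls [] = sym (ℤ.+-identityʳ _)
    length-foldl-step ls {x ∷ J} (a≤x ∷ a≤J) = begin
      + length (foldl step (step ls x) J)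
        ≡⟨ length-foldl-step (step ls x) a≤J ⟩
      + length (step ls x) ℤ.+ cost (prune (step ls x)) J
        ≡⟨ cong₂ (λ n s → + n ℤ.+ cost s J)
             (trans (length-step a≤x ls) (ℕ.+-comm (opens (prune ls) x) (length ls))) (sym (next-prune a≤x ls)) ⟩
      + (length ls ℕ.+ opens (prune ls) x) ℤ.+ cost (next (prune ls) x) J
        ≡⟨ ℤ.+-assoc (+ length ls) (+ opens (prune ls) x) (cost (next (prune ls) x) J) ⟩
      + length ls ℤ.+ cost (prune ls) (x ∷ J) ∎
      where open ≡-Reasoning

    BF-cost : ∀ {J} → All (a ℕ.≤_) J → + BF (map frac J) ≡ cost [] J
    BF-cost {J} a≤J = begin
      + length (foldl bfStep [] (map frac J))  ≡⟨ cong (λ l → + length l) (foldl-frac [] J) ⟩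
      + length (map frac (foldl step [] J))    ≡⟨ cong +_ (List.length-map frac (foldl step [] J)) ⟩
      + length (foldl step [] J)               ≡⟨ length-foldl-step [] a≤J ⟩
      + 0 ℤ.+ cost [] J                        ≡⟨ ℤ.+-identityˡ _ ⟩
      cost [] J                                ∎
      where open ≡-Reasoning

    sum-BF : ∀ {I} → All (a ℕ.≤_) I → + sumℕ (map BF (perms (map frac I))) ≡ total I []
    sum-BF {I} a≤I = begin
      + sumℕ (map BF (perms (map frac I)))           ≡⟨ sumℕ-∑ BF (perms (map frac I)) ⟩
      ∑ (perms (map frac I)) (λ J → + BF J)          ≡⟨ cong (λ l → ∑ l (λ J → + BF J)) (perms-map frac I) ⟩
      ∑ (map (map frac) (perms I)) (λ J → + BF J)    ≡⟨ ∑-map (map frac) (perms I) (λ J → + BF J) ⟩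
      ∑ (perms I) (λ J → + BF (map frac J))          ≡⟨ ∑-cong-All (All.map BF-cost (perms-All a≤I)) ⟩
      total I []                                     ∎
      where open ≡-Reasoning

-- Bin loads, feasible packings and optimality.

module Loads where

  open import Data.Rational using (_+_; _≤_)

  ∑ℚ : List ℚ → ℚ
  ∑ℚ []       = 0ℚ
  ∑ℚ (x ∷ xs) = x + ∑ℚ xs

  sumℚ-∑ℚ : ∀ xs → sumℚ xs ≡ ∑ℚ xs
  sumℚ-∑ℚ xs = trans (go 0ℚ xs) (ℚ.+-identityˡ _)
    where
    go : ∀ s xs → foldl _+_ s xs ≡ s + ∑ℚ xs
    go s []       = sym (ℚ.+-identityʳ s)
    go s (x ∷ xs) = trans (go (s + x) xs) (ℚ.+-assoc s x (∑ℚ xs))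

  ∑ℚ-++ : ∀ xs ys → ∑ℚ (xs ++ ys) ≡ ∑ℚ xs + ∑ℚ ys
  ∑ℚ-++ []       ys = sym (ℚ.+-identityˡ _)
  ∑ℚ-++ (x ∷ xs) ys = trans (cong (_+_ x) (∑ℚ-++ xs ys)) (sym (ℚ.+-assoc x (∑ℚ xs) (∑ℚ ys)))

  share : ∀ {k} → Fin k → ℚ → Fin k → ℚ
  share c x b = if does (c Fin.≟ b) then x else 0ℚ

  load-∷ : ∀ x I {k} (f : Fin (suc (length I)) → Fin k) b →
    load (x ∷ I) f b ≡ share (f zero) x b + load I (f ∘ suc) b
  load-∷ x I f b = begin
    sumℚ (map entry (allFin (suc (length I))))       ≡⟨ sumℚ-∑ℚ (map entry (allFin (suc (length I)))) ⟩
    entry zero + ∑ℚ (map entry (tabulate suc))       ≡⟨ cong (λ l → entry zero + ∑ℚ l)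
         (trans (List.map-tabulate suc entry) (sym (List.map-tabulate (λ i → i) (entry ∘ suc)))) ⟩
    entry zero + ∑ℚ (map (entry ∘ suc) (allFin (length I))) ≡⟨ cong (_+_ (entry zero)) (sumℚ-∑ℚ (map (entry ∘ suc) (allFin (length I)))) ⟨
    entry zero + load I (f ∘ suc) b                  ∎
    where
    open ≡-Reasoning
    entry : Fin (suc (length I)) → ℚ
    entry i = if does (f i Fin.≟ b) then lookup (x ∷ I) i else 0ℚ

  ∑Fin : ∀ k → (Fin k → ℚ) → ℚ
  ∑Fin zero    g = 0ℚ
  ∑Fin (suc k) g = g zero + ∑Fin k (g ∘ suc)

  ∑Fin-cong : ∀ k {g h : Fin k → ℚ} → (∀ b → g b ≡ h b) → ∑Fin k g ≡ ∑Fin k h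
  ∑Fin-cong zero    g≗h = refl
  ∑Fin-cong (suc k) g≗h = cong₂ _+_ (g≗h zero) (∑Fin-cong k (g≗h ∘ suc))

  ∑Fin-0 : ∀ k → ∑Fin k (λ _ → 0ℚ) ≡ 0ℚ
  ∑Fin-0 zero    = refl
  ∑Fin-0 (suc k) = trans (ℚ.+-identityˡ _) (∑Fin-0 k)

  ∑Fin-+ : ∀ k (g h : Fin k → ℚ) → ∑Fin k (λ b → g b + h b) ≡ ∑Fin k g + ∑Fin k h
  ∑Fin-+ zero    g h = refl
  ∑Fin-+ (suc k) g h = trans (cong (_+_ (g zero + h zero)) (∑Fin-+ k (g ∘ suc) (h ∘ suc)))
    (interchange (g zero) (h zero) (∑Fin k (g ∘ suc)) (∑Fin k (h ∘ suc)))
    where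
    open import Algebra.Properties.CommutativeSemigroup
      (CommutativeMonoid.commutativeSemigroup ℚ.+-0-commutativeMonoid) using (interchange)

  ∑Fin-share : ∀ {k} (c : Fin k) x → ∑Fin k (share c x) ≡ x
  ∑Fin-share {suc k} zero    x = trans (cong (_+_ x) (∑Fin-0 k)) (ℚ.+-identityʳ x)
  ∑Fin-share {suc k} (suc c) x = trans (ℚ.+-identityˡ _)
    (trans (∑Fin-cong k (λ b → refl)) (∑Fin-share c x))

  -- Double counting: each item contributes its size to exactly one bin.
  ∑Fin-load : ∀ I {k} (f : Fin (length I) → Fin k) → ∑Fin k (load I f) ≡ ∑ℚ I
  ∑Fin-load []      {k} f = ∑Fin-0 k
  ∑Fin-load (x ∷ I) {k} f = begin
    ∑Fin k (load (x ∷ I) f)                                        ≡⟨ ∑Fin-cong k (load-∷ x I f) ⟩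
    ∑Fin k (λ b → share (f zero) x b + load I (f ∘ suc) b)         ≡⟨ ∑Fin-+ k (share (f zero) x) _ ⟩
    ∑Fin k (share (f zero) x) + ∑Fin k (load I (f ∘ suc))          ≡⟨ cong₂ _+_ (∑Fin-share (f zero) x) (∑Fin-load I (f ∘ suc)) ⟩
    x + ∑ℚ I                                                       ∎
    where open ≡-Reasoning

  ∑Fin-≤ : ∀ k {g : Fin k → ℚ} → (∀ b → g b ≤ 1ℚ) → ∑Fin k g ≤ fromℕ k
  ∑Fin-≤ zero    g≤1 = ℚ.≤-refl
  ∑Fin-≤ (suc k) {g} g≤1 = subst (∑Fin (suc k) g ≤_) fromℕ-suc (ℚ.+-mono-≤ (g≤1 zero) (∑Fin-≤ k (g≤1 ∘ suc)))
    where
    fromℕ-suc : 1ℚ + fromℕ k ≡ fromℕ (suc k)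
    -- With denominator 1, `frac` is `fromℕ`.
    fromℕ-suc = BestFit.frac-+ 0 1 k

  -- `Feasible` wants a function on the positions of the concatenated list. Pairing each item with
  -- its bin first avoids arithmetic on positions.
  labelled : (bins : List (List ℚ)) → List (ℚ × Fin (length bins))
  labelled []           = []
  labelled (bin ∷ bins) = map (_, zero) bin ++ map (map₂ suc) (labelled bins)

  labelled-items : ∀ bins → map proj₁ (labelled bins) ≡ concat bins
  labelled-items []           = refl
  labelled-items (bin ∷ bins) = begin
    map proj₁ (map (_, zero) bin ++ map (map₂ suc) (labelled bins))
      ≡⟨ List.map-++ proj₁ (map (_, zero) bin) _ ⟩
    map proj₁ (map (_, zero) bin) ++ map proj₁ (map (map₂ suc) (labelled bins))
      ≡⟨ cong₂ _++_ (trans (sym (List.map-∘ bin)) (List.map-id bin))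
           (trans (sym (List.map-∘ (labelled bins))) (labelled-items bins)) ⟩
    bin ++ concat bins ∎
    where open ≡-Reasoning

  labels : ∀ {k} (ps : List (ℚ × Fin k)) → Fin (length (map proj₁ ps)) → Fin k
  labels (p ∷ ps) zero    = proj₂ p
  labels (p ∷ ps) (suc i) = labels ps i

  labelLoad : ∀ {k} → Fin k → List (ℚ × Fin k) → ℚ
  labelLoad b ps = ∑ℚ (map (λ p → share (proj₂ p) (proj₁ p) b) ps)

  load-labels : ∀ {k} (ps : List (ℚ × Fin k)) b → load (map proj₁ ps) (labels ps) b ≡ labelLoad b ps
  load-labels []       b = refl
  load-labels (p ∷ ps) b = trans (load-∷ (proj₁ p) (map proj₁ ps) (labels (p ∷ ps)) b)
    (cong (_+_ (share (proj₂ p) (proj₁ p) b)) (load-labels ps b))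

  ∑ℚ-0 : {A : Set} (xs : List A) → ∑ℚ (map (λ _ → 0ℚ) xs) ≡ 0ℚ
  ∑ℚ-0 []       = refl
  ∑ℚ-0 (x ∷ xs) = trans (ℚ.+-identityˡ _) (∑ℚ-0 xs)

  labelLoad-labelled : ∀ bins b → labelLoad b (labelled bins) ≡ ∑ℚ (lookup bins b)
  labelLoad-labelled (bin ∷ bins) b = begin
    ∑ℚ (map g (map (_, zero) bin ++ map (map₂ suc) (labelled bins)))
      ≡⟨ cong ∑ℚ (List.map-++ g (map (_, zero) bin) _) ⟩
    ∑ℚ (map g (map (_, zero) bin) ++ map g (map (map₂ suc) (labelled bins)))
      ≡⟨ ∑ℚ-++ (map g (map (_, zero) bin)) _ ⟩
    ∑ℚ (map g (map (_, zero) bin)) + ∑ℚ (map g (map (map₂ suc) (labelled bins)))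
      ≡⟨ cong₂ (λ l r → ∑ℚ l + ∑ℚ r) (sym (List.map-∘ bin)) (sym (List.map-∘ (labelled bins))) ⟩
    ∑ℚ (map (λ x → share zero x b) bin) + ∑ℚ (map (λ p → share (suc (proj₂ p)) (proj₁ p) b) (labelled bins))
      ≡⟨ split b ⟩
    ∑ℚ (lookup (bin ∷ bins) b) ∎
    where
    open ≡-Reasoning
    g = λ (p : ℚ × Fin (length (bin ∷ bins))) → share (proj₂ p) (proj₁ p) b
    split : ∀ b → ∑ℚ (map (λ x → share zero x b) bin)
        + ∑ℚ (map (λ p → share (suc (proj₂ p)) (proj₁ p) b) (labelled bins)) ≡ ∑ℚ (lookup (bin ∷ bins) b)
    split zero    = trans (cong₂ _+_ (cong ∑ℚ (List.map-id bin)) (∑ℚ-0 (labelled bins))) (ℚ.+-identityʳ _)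
    split (suc b) = trans (cong (_+ labelLoad b (labelled bins)) (∑ℚ-0 bin))
      (trans (ℚ.+-identityˡ _) (labelLoad-labelled bins b))

  feasible : ∀ bins → (∀ b → ∑ℚ (lookup bins b) ≤ 1ℚ) → Feasible (concat bins) (length bins)
  feasible bins bins≤1 = subst (λ I → Feasible I (length bins)) (labelled-items bins)
    (labels (labelled bins) , λ b →
      subst (_≤ 1ℚ) (sym (trans (load-labels (labelled bins) b) (labelLoad-labelled bins b))) (bins≤1 b))

  fromℕ-cancel-≤ : ∀ {m n} → fromℕ m ≤ fromℕ n → m ℕ.≤ n
  fromℕ-cancel-≤ = BestFit.frac-cancel-≤ 0

  module PerfectPacking (B-1 : ℕ) where

    open BestFit B-1

    ∑ℚ-frac : ∀ xs → ∑ℚ (map frac xs) ≡ frac (sum xs)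
    ∑ℚ-frac []       = sym (frac-* 0)
    ∑ℚ-frac (x ∷ xs) = trans (cong (_+_ (frac x)) (∑ℚ-frac xs)) (frac-+ x (sum xs))

    sum-concat : ∀ {bins} → All (λ bin → sum bin ≡ B) bins → sum (concat bins) ≡ length bins ℕ.* B
    sum-concat [] = refl
    sum-concat {bin ∷ bins} (eq ∷ eqs) =
      trans (sum-++ bin (concat bins)) (cong₂ ℕ._+_ eq (sum-concat eqs))

    -- The volume bound: k bins hold total size at most k, while full bins have total size equal to
    -- their number.
    isOpt : ∀ {bins} → All (λ bin → sum bin ≡ B) bins → IsOpt (map frac (concat bins)) (length bins)
    isOpt {bins} full = subst₂ Feasible (List.concat-map bins) (List.length-map (map frac) bins)
        (feasible (map (map frac) bins) (load≤1 full))
      , λ k (f , f≤1) → fromℕ-cancel-≤ (subst (_≤ fromℕ k)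
          (trans (∑Fin-load (map frac (concat bins)) f) (trans (∑ℚ-frac (concat bins))
            (trans (cong frac (sum-concat full)) (frac-* (length bins)))))
          (∑Fin-≤ k f≤1))
      where
      load≤1 : ∀ {bins} → All (λ bin → sum bin ≡ B) bins →
        ∀ b → ∑ℚ (lookup (map (map frac) bins) b) ≤ 1ℚ
      load≤1 {bin ∷ _} (eq ∷ _) zero = ℚ.≤-reflexive (trans (∑ℚ-frac bin) (trans (cong frac eq) frac-B))
      load≤1 (_ ∷ eqs) (suc b) = load≤1 eqs b

open Loads

-- Closed sets of states by exhaustive search.

module Reachable {S Y : Set} (_≟_ : DecidableEquality S) (next : S → Y → S) (moves : List Y)
  {P : S → Set} (P? : ∀ s → Dec (P s)) where

  open DecMembership _≟_ using (_∈?_)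

  -- The first argument is fuel. Running out of it gives `false`, so `true` certifies a completed
  -- search.
  explore : ℕ → List S → List S → Bool
  explore zero    seen todo       = false
  explore (suc n) seen []         = true
  explore (suc n) seen (s ∷ todo) = if does (s ∈? seen) then explore n seen todo
    else (does (P? s) ∧ explore n (s ∷ seen) (map (next s) moves ++ todo))

  record Closure (seen todo : List S) : Set where
    field
      states : List S
      seen⊆  : ∀ {s} → s ∈ seen → s ∈ states
      todo⊆  : ∀ {s} → s ∈ todo → s ∈ states
      closed : ∀ {s y} → s ∈ states → y ∈ moves → next s y ∈ states
      holds  : ∀ {s} → s ∈ states → P s

  -- The invariant is that each successor of a seen state is seen or still to do. Once nothing is
  -- left to do, the seen states are closed.
  explore-sound : ∀ n seen todo → explore n seen todo ≡ true →
    (∀ {s} → s ∈ seen → P s) →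
    (∀ {s y} → s ∈ seen → y ∈ moves → next s y ∈ seen ⊎ next s y ∈ todo) →
    Closure seen todo
  explore-sound (suc n) seen [] _ P-seen next-seen = record
    { states = seen
    ; seen⊆  = λ s∈ → s∈
    ; todo⊆  = λ ()
    ; closed = λ s∈ y∈ → [ (λ h → h) , (λ ()) ]′ (next-seen s∈ y∈)
    ; holds  = P-seen
    }
  explore-sound (suc n) seen (s ∷ todo) eq P-seen next-seen with s ∈? seen
  ... | yes s∈seen = record
    { Closure rest
    ; todo⊆ = λ { (here refl) → Closure.seen⊆ rest s∈seen ; (there t∈) → Closure.todo⊆ rest t∈ }
    }
    where
    rest : Closure seen todo
    rest = explore-sound n seen todo eq P-seen λ t∈ y∈ →
      [ inj₁
      , (λ { (here e) → inj₁ (subst (_∈ seen) (sym e) s∈seen) ; (there h) → inj₂ h })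
      ]′ (next-seen t∈ y∈)
  ... | no _ with P? s
  ...   | yes ps = record
    { Closure rest
    ; seen⊆ = λ t∈ → Closure.seen⊆ rest (there t∈)
    ; todo⊆ = λ { (here refl) → Closure.seen⊆ rest (here refl)
                ; (there t∈) → Closure.todo⊆ rest (∈-++⁺ʳ (map (next s) moves) t∈) }
    }
    where
    rest : Closure (s ∷ seen) (map (next s) moves ++ todo)
    rest = explore-sound n (s ∷ seen) (map (next s) moves ++ todo) eq
      (λ { (here refl) → ps ; (there t∈) → P-seen t∈ })
      (λ { (here refl) y∈ → inj₂ (∈-++⁺ˡ (∈-map⁺ (next s) y∈))
         ; (there t∈) y∈ → [ (λ h → inj₁ (there h))
             , (λ { (here e) → inj₁ (here e) ; (there h) → inj₂ (∈-++⁺ʳ (map (next s) moves) h) }) ]′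
             (next-seen t∈ y∈) })
  explore-sound (suc n) seen (s ∷ todo) () P-seen next-seen | no _ | no _

-- The block of sizes and its credit function.

open BestFit 171
open Open 42
open PerfectPacking 171

patterns : List (List ℕ)
patterns =
  (42 ∷ 42 ∷ 42 ∷ 46 ∷ []) ∷ (43 ∷ 43 ∷ 43 ∷ 43 ∷ []) ∷ (47 ∷ 47 ∷ 78 ∷ []) ∷ (53 ∷ 53 ∷ 66 ∷ []) ∷ []

block : List ℕ
block = concat patterns

-- Each entry covers the loads up to and including `t`. The tables end at 130 = 172 - 42, the
-- largest live load, so the default 0 is never read on a pruned state.
stepFunction : List (ℕ × ℕ) → ℕ → ℕ
stepFunction []             l = 0
stepFunction ((t , v) ∷ ts) l = if does (l ℕ.≤? t) then v else stepFunction ts l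

-- A state lists the loads of the open bins in the order of opening.  The values, in
-- units of 1/10000 bin, maximise the drift (a linear program), up to rounding.
youngest older : ℕ → ℕ
youngest = stepFunction
  ( (42 , 7328) ∷ (43 , 7234) ∷ (46 , 6632) ∷ (47 , 6489) ∷ (53 , 6199) ∷ (66 , 5899)
  ∷ (78 , 5411) ∷ (84 , 4980) ∷ (86 , 4756) ∷ (88 , 3935) ∷ (94 , 3269) ∷ (106 , 3163)
  ∷ (119 , 3068) ∷ (125 , 2999) ∷ (126 , 2985) ∷ (129 , 2974) ∷ (130 , 3107) ∷ [])
older = stepFunction ((106 , 3109) ∷ (119 , 2938) ∷ (125 , 3126) ∷ (130 , 3220) ∷ [])

credit : List ℕ → ℕ
credit []           = 0
credit (l ∷ [])     = youngest l
credit (l ∷ l′ ∷ s) = older l ℕ.+ credit (l′ ∷ s)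

-- 4.5762 bins per block in units of 1/10000, one unit above the rate 45761 with which `Bound` is
-- opened.
Drifts : List ℕ → Set
Drifts s = + 45762 ℤ.≤ ∑ block (λ y → + 10000 ℤ.* + opens s y ℤ.+ + credit s ℤ.- + credit (next s y))

open Reachable (List.≡-dec ℕ._≟_) next block {Drifts} (λ s → + 45762 ℤ.≤? _)

-- 331 states with 14 successors each are popped in fewer than 4700 steps.
abstract
  closure : Closure [] [ [] ]
  closure = explore-sound 4700 [] [ [] ] refl (λ ()) (λ ())

-- Instances made of copies of the block.

packing : ℕ → List (List ℕ)
packing zero    = []
packing (suc t) = patterns ++ packing t

length-packing : ∀ t → length (packing t) ≡ t ℕ.* 4
length-packing zero    = refl
length-packing (suc t) = cong (4 ℕ.+_) (length-packing t)

packing-full : ∀ t → All (λ bin → sum bin ≡ B) (packing t)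
packing-full zero    = []
packing-full (suc t) = refl ∷ refl ∷ refl ∷ refl ∷ packing-full t

-- Abstract, so that no conversion check ever enumerates the orderings of the items.
abstract
  items : ℕ → List ℕ
  items t = concat (packing t)

  items-packing : ∀ t → items t ≡ concat (packing t)
  items-packing t = refl

  length-items : ∀ t → length (items t) ≡ t ℕ.* 14
  length-items zero    = refl
  length-items (suc t) = cong (14 ℕ.+_) (length-items t)

  items-suc : ∀ t → items (suc t) ≡ block ++ items t
  items-suc t = sym (List.concat-++ patterns (packing t))

  items-All : ∀ {P : ℕ → Set} → All P block → ∀ t → All P (items t)
  items-All P-block zero    = []
  items-All P-block (suc t) = subst (All _) (sym (items-suc t)) (All.++⁺ P-block (items-All P-block t))

  ∑-items : ∀ f → ∑ block f ≡ 0ℤ → ∀ t → ∑ (items t) f ≡ 0ℤ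
  ∑-items f ∑≡0 zero    = refl
  ∑-items f ∑≡0 (suc t) = trans (cong (λ I → ∑ I f) (items-suc t))
    (trans (∑-++ block (items t) f) (cong₂ ℤ._+_ ∑≡0 (∑-items f ∑≡0 t)))

42≤block≤172 : All (λ x → (42 ℕ.≤ x) × (x ℕ.≤ B)) block
42≤block≤172 = from-yes (all? (λ x → (42 ℕ.≤? x) ×-dec (x ℕ.≤? B)) block)

0<frac : ∀ {k} → 0 ℕ.< k → 0ℚ ℚ.< frac k
0<frac 0<k = ℚ.≰⇒> λ h → ℕ.<⇒≱ 0<k (frac-cancel-≤ (ℚ.≤-trans h (ℚ.≤-reflexive (sym (frac-* 0)))))

valid : ∀ t → ValidInstance (map frac (items t))
valid t = All.map⁺ (All.map
  (λ (42≤x , x≤B) → 0<frac (ℕ.≤-trans (ℕ.s≤s ℕ.z≤n) 42≤x) , ℚ.≤-trans (frac-mono-≤ x≤B) (ℚ.≤-reflexive frac-B))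
  (items-All 42≤block≤172 t))

items-opt : ∀ t → IsOpt (map frac (items t)) (t ℕ.* 4)
items-opt t = subst₂ (λ I → IsOpt (map frac I)) (sym (items-packing t)) (length-packing t)
  (isOpt (packing-full t))

-- The existential stands before `n` and `I`: the loss is one constant for all instances, so it
-- becomes negligible as `n` grows.
total-bound : Σ ℕ λ l → ∀ n .⦃ _ : NonZero n ⦄ I → length I ≡ n → All (_∈ block) I →
  (∀ f → ∑ block f ≡ 0ℤ → ∑ I f ≡ 0ℤ) →
  + (n !) ℤ.* (+ 45761 ℤ.* + n ℤ.- + l) ℤ.≤ + length block ℤ.* + 10000 ℤ.* total I []
total-bound = loss , λ n I |I| I⊆ balanced →
  -- The empty list of bins is the root of the search and has credit 0.
  balanced-bound n {I} {[]} |I| I⊆ (todo⊆ (here refl)) refl balanced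
  where
  open Reachable.Closure closure
  open Bound 10000 credit block states 45761 closed holds

-- Comparison of the expectation with the optimum.

*-/-< : ∀ a b-1 m S n .⦃ _ : NonZero n ⦄ → + a ℤ.* + m ℤ.* + n ℤ.< + S ℤ.* + suc b-1 →
  (+ a / suc b-1) ℚ.* fromℕ m ℚ.< + S / n
*-/-< a b-1 m S n@(suc n-1) h = ℚ.toℚᵘ-cancel-<
  (ℚᵘ.<-respˡ-≃ (ℚᵘ.≃-sym (ℚᵘ.≃-trans (ℚ.toℚᵘ-homo-* (+ a / suc b-1) (fromℕ m))
      (ℚᵘ.*-cong (ℚ.toℚᵘ-fromℚᵘ (mkℚᵘ (+ a) b-1)) (ℚ.toℚᵘ-fromℚᵘ (mkℚᵘ (+ m) 0)))))
    (ℚᵘ.<-respʳ-≃ (ℚᵘ.≃-sym (ℚ.toℚᵘ-fromℚᵘ (mkℚᵘ (+ S) n-1)))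
      (*<* (subst (λ d → + a ℤ.* + m ℤ.* + n ℤ.< + S ℤ.* + d) (sym (ℕ.*-identityʳ (suc b-1))) h))))

+-cancelʳ-< : ∀ {i j} k → i ℤ.+ k ℤ.< j ℤ.+ k → i ℤ.< j
+-cancelʳ-< k h = ℤ.≰⇒> λ j≤i → ℤ.<⇒≱ h (ℤ.+-monoˡ-≤ k j≤i)

|block|≡14 : length block ≡ 14
|block|≡14 = refl

-- Symbolic coefficients keep the solver from unrolling large numerals.
overtake : ∀ c r k F W l t → + 5 ℤ.* r ≡ + 4 ℤ.* c ℤ.+ 1ℤ → 0ℤ ℤ.< F → 5 ℕ.* l ℕ.< t ℕ.* 14 →
  F ℤ.* (r ℤ.* + (t ℕ.* 14) ℤ.- + l) ℤ.≤ + length block ℤ.* k ℤ.* W →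
  c ℤ.* + (t ℕ.* 4) ℤ.* F ℤ.< W ℤ.* (+ 5 ℤ.* k)
overtake c r k F W l t 5r≡4c+1 0<F 5l<14t h = ℤ.*-cancelˡ-<-nonNeg (+ 14) (+-cancelʳ-< (F ℤ.* + (5 ℕ.* l))
  (begin-strict
  + 14 ℤ.* A ℤ.+ F ℤ.* + (5 ℕ.* l)
    <⟨ ℤ.+-monoʳ-< (+ 14 ℤ.* A) (ℤ.*-monoˡ-<-pos F ⦃ ℤ.positive 0<F ⦄ (ℤ.+<+ 5l<14t)) ⟩
  + 14 ℤ.* A ℤ.+ F ℤ.* + (t ℕ.* 14)
    ≡⟨ cong₂ (λ x y → + 14 ℤ.* (c ℤ.* x ℤ.* F) ℤ.+ F ℤ.* y) (ℤ.pos-* t 4) (ℤ.pos-* t 14) ⟩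
  + 14 ℤ.* (c ℤ.* (T ℤ.* + 4) ℤ.* F) ℤ.+ F ℤ.* (T ℤ.* + 14)
    ≡⟨ solve 3 (λ c F T → con (+ 14) :* (c :* (T :* con (+ 4)) :* F) :+ F :* (T :* con (+ 14))
         := (con (+ 4) :* c :+ con 1ℤ) :* (F :* (T :* con (+ 14)))) refl c F T ⟩
  (+ 4 ℤ.* c ℤ.+ 1ℤ) ℤ.* (F ℤ.* (T ℤ.* + 14))
    ≡⟨ cong (ℤ._* (F ℤ.* (T ℤ.* + 14))) 5r≡4c+1 ⟨
  + 5 ℤ.* r ℤ.* (F ℤ.* (T ℤ.* + 14))
    ≡⟨ solve 4 (λ r F T l → con (+ 5) :* r :* (F :* (T :* con (+ 14)))
         := con (+ 5) :* (F :* (r :* (T :* con (+ 14)) :- l)) :+ F :* (con (+ 5) :* l)) refl r F T (+ l) ⟩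
  + 5 ℤ.* (F ℤ.* (r ℤ.* (T ℤ.* + 14) ℤ.- + l)) ℤ.+ F ℤ.* (+ 5 ℤ.* + l)
    ≡⟨ cong₂ (λ x y → + 5 ℤ.* (F ℤ.* (r ℤ.* x ℤ.- + l)) ℤ.+ F ℤ.* y)
         (sym (ℤ.pos-* t 14)) (sym (ℤ.pos-* 5 l)) ⟩
  + 5 ℤ.* (F ℤ.* (r ℤ.* + (t ℕ.* 14) ℤ.- + l)) ℤ.+ F ℤ.* + (5 ℕ.* l)
    ≤⟨ ℤ.+-monoˡ-≤ (F ℤ.* + (5 ℕ.* l)) (ℤ.*-monoˡ-≤-nonNeg (+ 5) h) ⟩
  + 5 ℤ.* (+ length block ℤ.* k ℤ.* W) ℤ.+ F ℤ.* + (5 ℕ.* l)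
    ≡⟨ cong (λ b → + 5 ℤ.* (+ b ℤ.* k ℤ.* W) ℤ.+ F ℤ.* + (5 ℕ.* l)) |block|≡14 ⟩
  + 5 ℤ.* (+ 14 ℤ.* k ℤ.* W) ℤ.+ F ℤ.* + (5 ℕ.* l)
    ≡⟨ cong (ℤ._+ F ℤ.* + (5 ℕ.* l))
         (solve 2 (λ k W → con (+ 5) :* (con (+ 14) :* k :* W) := con (+ 14) :* (W :* (con (+ 5) :* k))) refl k W) ⟩
  + 14 ℤ.* (W ℤ.* (+ 5 ℤ.* k)) ℤ.+ F ℤ.* + (5 ℕ.* l) ∎))
  where
  open ℤ.≤-Reasoning
  open +-*-Solver
  T = + t
  A = c ℤ.* + (t ℕ.* 4) ℤ.* F

expectedBF-bound : ∀ I t l → length I ≡ t ℕ.* 14 → All (42 ℕ.≤_) I → 5 ℕ.* l ℕ.< t ℕ.* 14 →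
  + ((t ℕ.* 14) !) ℤ.* (+ 45761 ℤ.* + (t ℕ.* 14) ℤ.- + l) ℤ.≤ + length block ℤ.* + 10000 ℤ.* total I [] →
  (+ 57201 / 50000) ℚ.* fromℕ (t ℕ.* 4) ℚ.< expectedBF (map frac I)
expectedBF-bound I t l |I| 42≤I 5l<14t h =
  *-/-< 57201 49999 (t ℕ.* 4) (sumℕ (map BF (perms (map frac I)))) (length (map frac I) !)
    ⦃ length (map frac I) ℕ.!≢0 ⦄
    (subst₂ (λ n W → + 57201 ℤ.* + (t ℕ.* 4) ℤ.* + (n !) ℤ.< W ℤ.* + 50000)
      (sym (trans (List.length-map frac I) |I|)) (sym (sum-BF 42≤I)) bound)
  where
  bound : + 57201 ℤ.* + (t ℕ.* 4) ℤ.* + ((t ℕ.* 14) !) ℤ.< total I [] ℤ.* + 50000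
  -- Here `refl` checks 5·45761 = 4·57201 + 1: the ratio 57201/50000 lies just below the rate
  -- 45761/40000, and the excess 1, taken 14t times, outweighs 5l.
  bound = overtake (+ 57201) (+ 45761) (+ 10000) (+ ((t ℕ.* 14) !)) (total I []) l t refl
    (ℤ.+<+ (ℕ.n≢0⇒n>0 (ℕ.≢-nonZero⁻¹ _ ⦃ (t ℕ.* 14) ℕ.!≢0 ⦄))) 5l<14t h

5l<14t : ∀ M l → 5 ℕ.* l ℕ.< suc (M ℕ.+ l) ℕ.* 14
5l<14t M l = begin-strict
  5 ℕ.* l                  ≡⟨ ℕ.*-comm 5 l ⟩
  l ℕ.* 5                  ≤⟨ ℕ.*-mono-≤ (ℕ.m≤n+m l M) (ℕ.m≤m+n 5 9) ⟩
  (M ℕ.+ l) ℕ.* 14         <⟨ ℕ.m<n+m ((M ℕ.+ l) ℕ.* 14) (ℕ.s≤s ℕ.z≤n) ⟩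
  suc (M ℕ.+ l) ℕ.* 14     ∎
  where open ℕ.≤-Reasoning

open import Data.Rational using (_*_; _<_)

-- A limsup of suprema is at least c once ratios above c occur for arbitrarily large optimum. A
-- fixed c above 1.144 keeps the inequality strict in the limit.
theorem1p2 : Σ ℚ λ c → ((+ 1144) / 1000 < c) ×
    ((M : ℕ) → Σ ℕ λ m → (M Data.Nat.≤ m) × Σ (List ℚ) λ I →
    ValidInstance I × IsOpt I m × (c * fromℕ m < expectedBF I))
theorem1p2 = + 57201 / 50000 , from-yes ((+ 1144 / 1000) ℚ.<? (+ 57201 / 50000)) , λ M →
  let (l , bound) = total-bound
      -- Large enough both for 4t ≥ M and for 14t to exceed 5l.
      t = suc (M ℕ.+ l)
  in t ℕ.* 4
   , ℕ.≤-trans (ℕ.≤-trans (ℕ.m≤m+n M l) (ℕ.n≤1+n (M ℕ.+ l))) (ℕ.m≤m*n t 4)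
   , map frac (items t) , valid t
   , items-opt t
   , expectedBF-bound (items t) t l (length-items t) (All.map proj₁ (items-All 42≤block≤172 t))
       (5l<14t M l)
       (bound (t ℕ.* 14) (items t) (length-items t)
         (items-All (All.tabulate (λ y∈ → y∈)) t) (λ f ∑≡0 → ∑-items f ∑≡0 t))
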